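{- Let $N\geq 1$ and $K\geq N$ be integers, and set $C=\left\lfloor \frac{K-1}{K+1-N}\right\rfloor+1$. Let $$W_{K,N}=\{[0;d_1,d_2,\ldots]_N\in[0,1]\setminus\mathbb{Q}\,:\, d_n\geq K\text{ for all }n\geq 1\}.$$ Then the following hold. (1) For all $x\in W_{K,N}$ the dual NCF sequence $\widehat{\omega}(x,N)$ is $C$-balanced. (2) For all $x\in W_{K,N}$ the NCF sequence $\omega(x,N)$ is $N\cdot C$-balanced.
   Context: Let $N\ge 1$ be an integer and define $T_N:[0,1]\to[0,1]$ by $T_N(x)=\frac{N}{x}-\lfloor\frac{N}{x}\rfloor$ for $x\ne0$ and $T_N(0)=0$. For $x\in[0,1]\setminus\mathbb{Q}$ the (greedy) NCF digits of $x$ are $d_n=\lfloor N/T_N^{n-1}(x)\rfloor$, $n\ge1$; they satisfy $d_n\ge N$, and one writes $x=[0;d_1,d_2,\ldots]_N=\cfrac{N}{d_1+\cfrac{N}{d_2+\cdots}}$. Every integer sequence $(d_n)_{n\geq 1}$ with $d_n\ge N$ occurs for exactly one irrational $x\in[0,1]$. A substitution on $\{0,1\}$ is given by images of the letters (nonempty words) and extends to finite words and to infinite words in $\{0,1\}^{\mathbb{N}}$ by concatenation. For $x=[0;d_1,d_2,\ldots]_N$ irrational let $\sigma_n(0)=0^{d_n}1^N$, $\sigma_n(1)=0$ and $\widehat\sigma_n(0)=0^{d_n}1$, $\widehat\sigma_n(1)=0^N$ for $n\ge1$. The NCF sequence $\omega(x,N)\in\{0,1\}^{\mathbb N}$ is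 the unique infinite word $\omega$ for which there exist $\omega^{(1)},\omega^{(2)},\ldots\in\{0,1\}^{\mathbb{N}}$ with $\omega^{(1)}=\omega$ and $\omega^{(n)}=\sigma_n(\omega^{(n+1)})$ for all $n\ge1$. The dual NCF sequence $\widehat\omega(x,N)$ is defined in the same way with $\widehat\sigma_n$ in place of $\sigma_n$. For a finite word $u$, $|u|$ is its length and $|u|_a$ the number of occurrences of the letter $a$ in $u$. A sequence $\nu\in\{0,1\}^{\mathbb{N}}$ is $C$-balanced ($C>0$) if for all finite factors (contiguous subwords) $u,v$ of $\nu$ with $|u|=|v|$ one has $-C\le|u|_a-|v|_a\le C$ for every letter $a$. -}

module Defs where

open import Data.Fin using (Fin)
open import Data.Fin.Patterns using (0F; 1F)
open import Data.Fin.Properties using (_≟_)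
open import Data.Integer as ℤ using (+_)
open import Data.List using (List; []; _∷_; length; filter; applyUpTo; replicate)
open import Data.List.NonEmpty as List⁺ using (List⁺; _∷_; _++⁺_)
open import Data.Nat
  using (ℕ; zero; suc; _+_; _*_; _∸_; _≤_; NonZero; z<s; >-nonZero; ≢-nonZero⁻¹)
open import Data.Nat.DivMod using (_/_)
open import Data.Nat.Properties using (m<n⇒0<n∸m; ≤-<-trans; m<m+n)
open import Data.Product using (∃; _×_)
open import Data.Rational as ℚ using (ℚ; 0ℚ; 1ℚ)
open import Data.Sum using (_⊎_)
open import Function using (_∘_)
open import Relation.Binary.PropositionalEquality using (_≡_; _≗_)
open import Relation.Nullary using (¬_)

-- Real numbers are Dedekind cuts over ℚ: `L x q` means q < x and `U x q` means
-- x < q.  Arithmetic is defined on the underlying pairs of predicates, the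
-- axioms of a real number being the separate predicate IsReal.

record Cut : Set₁ where
  field
    L U : ℚ → Set

open Cut public

record IsReal (x : Cut) : Set where
  field
    L-inhabited : ∃ (L x)
    U-inhabited : ∃ (U x)
    L-lower     : ∀ {q r} → q ℚ.< r → L x r → L x q
    U-upper     : ∀ {q r} → q ℚ.< r → U x q → U x r
    L-open      : ∀ {q} → L x q → ∃ λ r → q ℚ.< r × L x r
    U-open      : ∀ {r} → U x r → ∃ λ q → q ℚ.< r × U x q
    disjoint    : ∀ {q} → ¬ (L x q × U x q)
    located     : ∀ {q r} → q ℚ.< r → L x q ⊎ U x r

fromℕ : ℕ → ℚ
fromℕ n = + n ℚ./ 1

-- x ≤ q and q ≤ x are the negations of q < x and x < q.
infix 4 _≤ʳ_ _ʳ≤_ _≈ʳ_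

_≤ʳ_ : Cut → ℚ → Set
x ≤ʳ q = ¬ L x q

_ʳ≤_ : ℚ → Cut → Set
q ʳ≤ x = ¬ U x q

_≈ʳ_ : Cut → ℚ → Set
x ≈ʳ q = x ≤ʳ q × q ʳ≤ x

record IrrationalInUnitInterval (x : Cut) : Set where
  field
    isReal     : IsReal x
    0≤x        : 0ℚ ʳ≤ x
    x≤1        : x ≤ʳ 1ℚ
    irrational : ∀ q → ¬ (x ≈ʳ q)

-- The quotient N/x for a real x > 0:
--   q < N/x  iff  q r ≤ N for some rational r > x,
--   N/x < q  iff  N ≤ q r for some rational r with 0 < r < x.
infixl 7 _÷_

_÷_ : ℕ → Cut → Cut
L (N ÷ x) q = ∃ λ r → U x r × q ℚ.* r ℚ.≤ fromℕ N
U (N ÷ x) q = ∃ λ r → 0ℚ ℚ.< r × L x r × fromℕ N ℚ.≤ q ℚ.* r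

infixl 6 _-ʳ_

_-ʳ_ : Cut → ℕ → Cut
L (z -ʳ m) q = L z (q ℚ.+ fromℕ m)
U (z -ʳ m) q = U z (q ℚ.+ fromℕ m)

IsFloor : ℕ → Cut → Set
IsFloor m z = fromℕ m ʳ≤ z × U z (fromℕ (suc m))

-- Sequences are indexed from 0: `d n` is the digit dₙ₊₁.
--
-- The floor of a real is not computable, so the digits are specified by a
-- relation.  When d satisfies IsNCFDigits N x d, `orbit N x d n` is the n-fold
-- iterate of T_N at x.  The iterates of an irrational x are irrational, so the
-- clause T_N(0) = 0 is never used and every division is by a positive real.

orbit : ℕ → Cut → (ℕ → ℕ) → ℕ → Cut
orbit N x d zero    = x
orbit N x d (suc n) = (N ÷ orbit N x d n) -ʳ d n

IsNCFDigits : ℕ → Cut → (ℕ → ℕ) → Set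
IsNCFDigits N x d = ∀ n → IsFloor (d n) (N ÷ orbit N x d n)

W : ℕ → ℕ → Cut → Set
W K N x =
  IrrationalInUnitInterval x ×
  ∃ λ d → IsNCFDigits N x d × (∀ n → K ≤ d n)

Letter : Set
Letter = Fin 2

Word∞ : Set
Word∞ = ℕ → Letter

Substitution : Set
Substitution = Letter → List⁺ Letter

-- `emit σ u w` is the infinite word u σ(w₀) σ(w₁) σ(w₂) ⋯
emit : Substitution → List⁺ Letter → Word∞ → Word∞
emit σ (a ∷ _)       w zero    = a
emit σ (a ∷ [])      w (suc k) = emit σ (σ (w 0)) (w ∘ suc) k
emit σ (a ∷ (b ∷ u)) w (suc k) = emit σ (b ∷ u) w k

_⟨_⟩ : Substitution → Word∞ → Word∞
σ ⟨ w ⟩ = emit σ (σ (w 0)) (w ∘ suc)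

-- aⁿ as a nonempty word.
power⁺ : Letter → (n : ℕ) .{{_ : NonZero n}} → List⁺ Letter
power⁺ a n = List⁺.replicate n (≢-nonZero⁻¹ n) a

-- `ωs n` is the word ω⁽ⁿ⁺¹⁾.
IsDirectedBy : (ℕ → Substitution) → Word∞ → Set
IsDirectedBy σ ω =
  ∃ λ (ωs : ℕ → Word∞) →
    ωs 0 ≗ ω × (∀ n → ωs n ≗ σ n ⟨ ωs (suc n) ⟩)

module _ (N : ℕ) .{{_ : NonZero N}} where

  ncfSubst : ℕ → Substitution
  ncfSubst m 0F = replicate m 0F ++⁺ power⁺ 1F N
  ncfSubst m 1F = List⁺.[ 0F ]

  dualNCFSubst : ℕ → Substitution
  dualNCFSubst m 0F = replicate m 0F ++⁺ List⁺.[ 1F ]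
  dualNCFSubst m 1F = power⁺ 0F N

  IsNCFSequence : Cut → Word∞ → Set
  IsNCFSequence x ω =
    ∃ λ d → IsNCFDigits N x d × IsDirectedBy (ncfSubst ∘ d) ω

  IsDualNCFSequence : Cut → Word∞ → Set
  IsDualNCFSequence x ω =
    ∃ λ d → IsNCFDigits N x d × IsDirectedBy (dualNCFSubst ∘ d) ω

∣_∣[_] : List Letter → Letter → ℕ
∣ u ∣[ a ] = length (filter (a ≟_) u)

IsFactor : List Letter → Word∞ → Set
IsFactor u ν = ∃ λ i → applyUpTo (λ j → ν (i + j)) (length u) ≡ u

Balanced : ℕ → Word∞ → Set
Balanced C ν =
  ∀ u v → IsFactor u ν → IsFactor v ν → length u ≡ length v →
  ∀ a → ℤ.- (+ C) ℤ.≤ + ∣ u ∣[ a ] ℤ.- + ∣ v ∣[ a ] ×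
        + ∣ u ∣[ a ] ℤ.- + ∣ v ∣[ a ] ℤ.≤ + C

-- ⌊(K − 1)/(K + 1 − N)⌋ + 1.  For 1 ≤ N ≤ K neither subtraction truncates.
balanceBound : (K N : ℕ) → N ≤ K → ℕ
balanceBound K N N≤K = (K ∸ 1) / (K + 1 ∸ N) + 1
  where instance
    nonZero : NonZero (K + 1 ∸ N)
    nonZero = >-nonZero (m<n⇒0<n∸m (≤-<-trans N≤K (m<m+n K z<s)))

{-# OPTIONS --safe #-}
module Submission where

-- Let Z and O count zeros and ones of prefixes.  If ν = σ̂(w) with digit d, a
-- position p of ν lies at most d letters after the start of the image of some
-- letter w_k, and O ν p = Z w k, since 1 only occurs at the end of σ̂(0).  Two
-- factors of ν of length n whose numbers of ones differ by more than C thus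
-- give factors A, B of w such that A has more than C zeros in excess over B,
-- while |σ̂(A)| ≤ |σ̂(B)| + 2d; for d ≥ K and the given C this forces B to have
-- more than C ones in excess over A.  Truncating the longer of A and B gives
-- two unbalanced factors of w of the same length, smaller than n: descent.
--
-- For the second part, let θ(0) = 0, θ(1) = 1ᴺ and τ(0) = 0ᵈ1, τ(1) = 0.  Then
-- σ = θτ and σ̂ = τθ, so ω = θ(ν) for a dual sequence ν, and unbalanced factors of
-- ω, rounded to whole blocks 1ᴺ, again give factors A, B of ν as above.

open import Defs
open import Data.Fin.Patterns using (0F; 1F)
open import Data.Fin.Properties using (_≟_)
open import Data.Integer as ℤ using (+_)
import Data.Integer.Properties as ℤ
open import Data.List
  using (List; []; _∷_; [_]; _++_; length; filter; applyUpTo; replicate; concatMap; take)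
open import Data.List.NonEmpty as List⁺ using (List⁺; _∷_; _++⁺_; _⁺++_; toList)
open import Data.List.Properties
  using (length-applyUpTo; applyUpTo-∷ʳ; length-++; length-replicate; filter-++; ++-assoc; ++-identityʳ)
open import Data.Nat
  using (ℕ; zero; suc; _+_; _*_; _∸_; _≤_; _<_; NonZero; >-nonZero; >-nonZero⁻¹; z≤n; s≤s; z<s; s<s; s≤s⁻¹)
open import Data.Nat.DivMod using (_/_; _%_; m≡m%n+[m/n]*n; m%n<n)
open import Data.Nat.Induction using (<-rec)
open import Data.Nat.Properties hiding (_≟_)
open import Data.Nat.Tactic.RingSolver using (solve-∀)
open import Data.Product using (∃; ∃₂; _×_; _,_)
open import Data.Rational as ℚ using ()
import Data.Rational.Properties as ℚ
import Data.Rational.Unnormalised as ℚᵘ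
import Data.Rational.Unnormalised.Properties as ℚᵘ
open import Data.Sum using (_⊎_; inj₁; inj₂)
open import Function using (_∘_)
open import Relation.Binary.PropositionalEquality
  using (_≡_; _≗_; refl; sym; trans; cong; cong₂; subst; subst₂; module ≡-Reasoning)
open import Relation.Nullary using (¬_)

-- Uniqueness of the NCF digits.

fromℕ-mono-≤ : ∀ {m n} → m ≤ n → fromℕ m ℚ.≤ fromℕ n
fromℕ-mono-≤ {m} {n} m≤n = ℚ.toℚᵘ-cancel-≤
  (ℚᵘ.≤-respˡ-≃ (ℚᵘ.≃-sym (ℚ.toℚᵘ-fromℚᵘ (+ m ℚᵘ./ 1)))
  (ℚᵘ.≤-respʳ-≃ (ℚᵘ.≃-sym (ℚ.toℚᵘ-fromℚᵘ (+ n ℚᵘ./ 1)))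
  (ℚᵘ.*≤* (ℤ.*-monoʳ-≤-nonNeg (+ 1) (ℤ.+≤+ m≤n)))))

U-÷-upper : ∀ N x {q r} → q ℚ.≤ r → U (N ÷ x) q → U (N ÷ x) r
U-÷-upper N x q≤r (s , 0<s , s<x , N≤qs) =
  s , 0<s , s<x , ℚ.≤-trans N≤qs (ℚ.*-monoʳ-≤-nonNeg s q≤r)
  where instance _ = ℚ.nonNegative (ℚ.<⇒≤ 0<s)

floor-≤ : ∀ N x m m′ → IsFloor m (N ÷ x) → IsFloor m′ (N ÷ x) → m′ ≤ m
floor-≤ N x m m′ (_ , z<1+m) (m′≤z , _) =
  ≮⇒≥ λ m<m′ → m′≤z (U-÷-upper N x (fromℕ-mono-≤ m<m′) z<1+m)

floor-unique : ∀ N x m m′ → IsFloor m (N ÷ x) → IsFloor m′ (N ÷ x) → m ≡ m′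
floor-unique N x m m′ f f′ = ≤-antisym (floor-≤ N x m′ m f′ f) (floor-≤ N x m m′ f f′)

module _ N x {d d′} (f : IsNCFDigits N x d) (f′ : IsNCFDigits N x d′) where

  -- Membership in `W` and being an NCF or dual sequence each bring a digit sequence of their own;
  -- this identifies the two. The inductions are intertwined: equal iterates have equal floors, and
  -- equal digits turn equal iterates into equal next iterates.
  orbit-unique : ∀ n → orbit N x d n ≡ orbit N x d′ n
  digits-unique : d ≗ d′

  orbit-unique zero    = refl
  orbit-unique (suc n) = cong₂ (λ y m → N ÷ y -ʳ m) (orbit-unique n) (digits-unique n)

  digits-unique n = floor-unique N (orbit N x d′ n) (d n) (d′ n)
    (subst (λ y → IsFloor (d n) (N ÷ y)) (orbit-unique n) (f n)) (f′ n)

-- Composition of substitutions on infinite words.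

emit-cong : ∀ σ u {w w′} → w ≗ w′ → emit σ u w ≗ emit σ u w′
emit-cong σ (a ∷ _)       w≗w′ zero    = refl
emit-cong σ (a ∷ [])      w≗w′ (suc k) rewrite w≗w′ 0 = emit-cong σ _ (w≗w′ ∘ suc) k
emit-cong σ (a ∷ (b ∷ u)) w≗w′ (suc k) = emit-cong σ (b ∷ u) w≗w′ k

⟨⟩-cong : ∀ σ {w w′} → w ≗ w′ → σ ⟨ w ⟩ ≗ σ ⟨ w′ ⟩
⟨⟩-cong σ w≗w′ k rewrite w≗w′ 0 = emit-cong σ _ (w≗w′ ∘ suc) k

image : Substitution → List Letter → List Letter
image σ = concatMap (toList ∘ σ)

toList-injective : ∀ {u v : List⁺ Letter} → toList u ≡ toList v → u ≡ v
toList-injective {_ ∷ _} {_ ∷ _} refl = refl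

module _ (σ τ ρ : Substitution) (ρ≡στ : ∀ a → toList (ρ a) ≡ image σ (toList (τ a))) where

  -- The form of `⟨⟩-∘` that survives induction on the position. Here `v` is the unread rest of the
  -- `σ`-image of the head of `t`; that head is therefore dropped on the left, and only the tail of
  -- `t` is mapped on the right.
  emit-∘ : ∀ v t w → emit σ v (emit τ t w ∘ suc) ≗ emit ρ (v ⁺++ image σ (List⁺.tail t)) w
  emit-∘ (a ∷ [])    (c ∷ [])    w zero = refl
  emit-∘ (a ∷ [])    (c ∷ e ∷ t) w zero = refl
  emit-∘ (a ∷ b ∷ v) (c ∷ t)     w zero = refl
  emit-∘ (a ∷ b ∷ v) (c ∷ t)     w (suc k) = emit-∘ (b ∷ v) (c ∷ t) w k
  emit-∘ (a ∷ [])    (c ∷ e ∷ t) w (suc k) = emit-∘ (σ e) (e ∷ t) w k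
  emit-∘ (a ∷ [])    (c ∷ [])    w (suc k) with τ (w 0) | ρ≡στ (w 0)
  ... | e ∷ t | ρw₀≡ = trans (emit-∘ (σ e) (e ∷ t) (w ∘ suc) k)
    (cong (λ u → emit ρ u (w ∘ suc) k) (toList-injective (sym ρw₀≡)))

  ⟨⟩-∘ : ∀ w → σ ⟨ τ ⟨ w ⟩ ⟩ ≗ ρ ⟨ w ⟩
  ⟨⟩-∘ w k with τ (w 0) | ρ≡στ (w 0)
  ... | e ∷ t | ρw₀≡ = trans (emit-∘ (σ e) (e ∷ t) (w ∘ suc) k)
    (cong (λ u → emit ρ u (w ∘ suc) k) (toList-injective (sym ρw₀≡)))

-- Prefixes of images, cut into blocks.

applyUpTo-cong : ∀ {ν ν′ : Word∞} → ν ≗ ν′ → ∀ n → applyUpTo ν n ≡ applyUpTo ν′ n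
applyUpTo-cong eq zero    = refl
applyUpTo-cong eq (suc n) = cong₂ _∷_ (eq 0) (applyUpTo-cong (eq ∘ suc) n)

applyUpTo-+ : ∀ (ν : Word∞) m n → applyUpTo ν (m + n) ≡ applyUpTo ν m ++ applyUpTo (λ j → ν (m + j)) n
applyUpTo-+ ν zero    n = refl
applyUpTo-+ ν (suc m) n = cong (ν 0 ∷_) (applyUpTo-+ (ν ∘ suc) m n)

emit-prefix : ∀ σ p u w →
  p < List⁺.length u × applyUpTo (emit σ u w) p ≡ take p (toList u) ⊎
  ∃₂ λ k r → r < List⁺.length (σ (w k)) ×
    applyUpTo (emit σ u w) p ≡ toList u ++ image σ (applyUpTo w k) ++ take r (toList (σ (w k)))
emit-prefix σ zero    u           w = inj₁ (z<s , refl)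
emit-prefix σ (suc p) (a ∷ b ∷ u) w with emit-prefix σ p (b ∷ u) w
... | inj₁ (p< , eq)         = inj₁ (s<s p< , cong (a ∷_) eq)
... | inj₂ (k , r , r< , eq) = inj₂ (k , r , r< , cong (a ∷_) eq)
emit-prefix σ (suc p) (a ∷ [])    w with emit-prefix σ p (σ (w 0)) (w ∘ suc)
... | inj₁ (p< , eq)         = inj₂ (0 , p , p< , cong (a ∷_) eq)
... | inj₂ (k , r , r< , eq) = inj₂ (suc k , r , r< , cong (a ∷_)
    (trans eq (sym (++-assoc (toList (σ (w 0))) (image σ (applyUpTo (w ∘ suc) k)) _))))

-- As `r` stays strictly below the block length, a position on a block boundary counts as offset 0
-- in the block that starts there.
⟨⟩-prefix : ∀ σ w p → ∃₂ λ k r → r < List⁺.length (σ (w k)) ×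
  applyUpTo (σ ⟨ w ⟩) p ≡ image σ (applyUpTo w k) ++ take r (toList (σ (w k)))
⟨⟩-prefix σ w p with emit-prefix σ p (σ (w 0)) (w ∘ suc)
... | inj₁ (p< , eq)         = 0 , p , p< , eq
... | inj₂ (k , r , r< , eq) = suc k , r , r< ,
    trans eq (sym (++-assoc (toList (σ (w 0))) (image σ (applyUpTo (w ∘ suc) k)) _))

-- Letter counts of words, images and prefixes.

count-++ : ∀ a u v → ∣ u ++ v ∣[ a ] ≡ ∣ u ∣[ a ] + ∣ v ∣[ a ]
count-++ a u v = trans (cong length (filter-++ (a ≟_) u v)) (length-++ (filter (a ≟_) u))

count-total : ∀ u → ∣ u ∣[ 0F ] + ∣ u ∣[ 1F ] ≡ length u
count-total []       = refl
count-total (0F ∷ u) = cong suc (count-total u)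
count-total (1F ∷ u) = trans (+-suc ∣ u ∣[ 0F ] ∣ u ∣[ 1F ]) (cong suc (count-total u))

count-same : ∀ a n → ∣ replicate n a ∣[ a ] ≡ n
count-same 0F zero    = refl
count-same 1F zero    = refl
count-same 0F (suc n) = cong suc (count-same 0F n)
count-same 1F (suc n) = cong suc (count-same 1F n)

-- Row `a` of the incidence matrix of `σ`, applied to the vector of letter counts of `u`.
count-image : ∀ σ a u → ∣ image σ u ∣[ a ] ≡
  ∣ toList (σ 0F) ∣[ a ] * ∣ u ∣[ 0F ] + ∣ toList (σ 1F) ∣[ a ] * ∣ u ∣[ 1F ]
count-image σ a [] = sym (cong₂ _+_ (*-zeroʳ ∣ toList (σ 0F) ∣[ a ]) (*-zeroʳ ∣ toList (σ 1F) ∣[ a ]))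
count-image σ a (0F ∷ u) rewrite count-++ a (toList (σ 0F)) (image σ u) | count-image σ a u =
  lemma ∣ toList (σ 0F) ∣[ a ] ∣ toList (σ 1F) ∣[ a ] ∣ u ∣[ 0F ] ∣ u ∣[ 1F ]
  where
  lemma : ∀ s t x y → s + (s * x + t * y) ≡ s * suc x + t * y
  lemma = solve-∀
count-image σ a (1F ∷ u) rewrite count-++ a (toList (σ 1F)) (image σ u) | count-image σ a u =
  lemma ∣ toList (σ 0F) ∣[ a ] ∣ toList (σ 1F) ∣[ a ] ∣ u ∣[ 0F ] ∣ u ∣[ 1F ]
  where
  lemma : ∀ s t x y → t + (s * x + t * y) ≡ s * x + t * suc y
  lemma = solve-∀

count : Letter → Word∞ → ℕ → ℕ
count a ν p = ∣ applyUpTo ν p ∣[ a ]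

Z O : Word∞ → ℕ → ℕ
Z = count 0F
O = count 1F

Z+O : ∀ ν p → Z ν p + O ν p ≡ p
Z+O ν p = trans (count-total (applyUpTo ν p)) (length-applyUpTo ν p)

count-+ : ∀ a ν m n → count a ν (m + n) ≡ count a ν m + ∣ applyUpTo (λ j → ν (m + j)) n ∣[ a ]
count-+ a ν m n = trans (cong ∣_∣[ a ] (applyUpTo-+ ν m n)) (count-++ a (applyUpTo ν m) _)

count-mono : ∀ a ν {p q} → p ≤ q → count a ν p ≤ count a ν q
count-mono a ν {p} p≤q with m≤n⇒∃[o]m+o≡n p≤q
... | n , refl = ≤-trans (m≤m+n _ _) (≤-reflexive (sym (count-+ a ν p n)))

count-cancel-< : ∀ a ν {p q} → count a ν p < count a ν q → p < q
count-cancel-< a ν c< = ≰⇒> λ q≤p → <⇒≱ c< (count-mono a ν q≤p)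

take-replicate-++ : ∀ (a : Letter) {r n} v → r ≤ n → take r (replicate n a ++ v) ≡ replicate r a
take-replicate-++ a v z≤n       = refl
take-replicate-++ a v (s≤s r≤n) = cong (a ∷_) (take-replicate-++ a v r≤n)

take-replicate : ∀ (a : Letter) {r n} → r ≤ n → take r (replicate n a) ≡ replicate r a
take-replicate a {r} {n} r≤n =
  trans (cong (take r) (sym (++-identityʳ (replicate n a)))) (take-replicate-++ a [] r≤n)

count-1-replicate-0 : ∀ n → ∣ replicate n 0F ∣[ 1F ] ≡ 0
count-1-replicate-0 zero    = refl
count-1-replicate-0 (suc n) = count-1-replicate-0 n

count-0-replicate-1 : ∀ n → ∣ replicate n 1F ∣[ 0F ] ≡ 0
count-0-replicate-1 zero    = refl
count-0-replicate-1 (suc n) = count-0-replicate-1 n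

toList-++⁺ : ∀ (u : List Letter) v → toList (u ++⁺ v) ≡ u ++ toList v
toList-++⁺ []      v = refl
toList-++⁺ (a ∷ u) v = cong (a ∷_) (toList-++⁺ u v)

-- Balance through prefix counts, and the truncation argument.

-- The ones in the factor of length `n` at `i` number `O ν (i + n)` minus `O ν i`; moving the
-- negative terms across avoids truncated subtraction. Exchanging `i` and `j` gives the opposite
-- bound, and equality of lengths gives the bounds for zeros.
OnesBalanced : ℕ → Word∞ → ℕ → Set
OnesBalanced C ν n = ∀ i j → O ν (i + n) + O ν j ≤ O ν (j + n) + O ν i + C

-- Truncating the longer of the two factors w[k, k′) and w[l, l′) to the length
-- of the shorter one preserves the excess of the letter that the shorter has more of.
no-double-excess : ∀ C w k k′ l l′ → (∀ m → m ≤ k′ ∸ k → OnesBalanced C w m) →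
  Z w l ≤ Z w l′ → Z w l′ + Z w k + C < Z w k′ + Z w l → ¬ (O w k′ + O w l + C < O w l′ + O w k)
no-double-excess C w k k′ l l′ bal Zl≤Zl′ hZ hO
  with m≤n⇒∃[o]m+o≡n (<⇒≤ k<k′) | m≤n⇒∃[o]m+o≡n (<⇒≤ l<l′)
  where
  Zk<Zk′ : Z w k < Z w k′
  Zk<Zk′ = +-cancelʳ-< (Z w l) _ _ (≤-<-trans (≤-trans (≤-reflexive (+-comm (Z w k) (Z w l)))
    (≤-trans (+-monoˡ-≤ (Z w k) Zl≤Zl′) (m≤m+n _ C))) hZ)
  k<k′ : k < k′
  k<k′ = count-cancel-< 0F w Zk<Zk′
  l<l′ : l < l′
  l<l′ = count-cancel-< 1F w (+-cancelʳ-< (O w k) _ _ (≤-<-trans (≤-trans (≤-reflexive (+-comm (O w l) (O w k)))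
    (≤-trans (+-monoˡ-≤ (O w l) (count-mono 1F w (<⇒≤ k<k′))) (m≤m+n _ C))) hO))
... | a , refl | b , refl rewrite m+n∸m≡n k a with ≤-total a b
... | inj₂ b≤a = <⇒≱ hO (≤-trans (bal b b≤a l k)
    (+-monoˡ-≤ C (+-monoˡ-≤ (O w l) (count-mono 1F w (+-monoʳ-≤ k b≤a)))))
-- At the common length `a`, more than `C` zeros in excess means more than `C` ones too few, which
-- `bal` excludes. Adding the two inequalities puts a number strictly below itself.
... | inj₁ a≤b = <-irrefl total (+-mono-<-≤ hZ′ (bal a ≤-refl l k))
  where
  hZ′ : Z w (l + a) + Z w k + C < Z w (k + a) + Z w l
  hZ′ = ≤-<-trans (+-monoˡ-≤ C (+-monoˡ-≤ (Z w k) (count-mono 0F w (+-monoʳ-≤ l a≤b)))) hZ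
  split : ∀ z₁ z₂ o₁ o₂ C → z₁ + z₂ + C + (o₁ + o₂) ≡ (z₁ + o₁) + (z₂ + o₂) + C
  split = solve-∀
  split′ : ∀ z₁ z₂ o₁ o₂ C → z₁ + z₂ + (o₁ + o₂ + C) ≡ (z₁ + o₁) + (z₂ + o₂) + C
  split′ = solve-∀
  swap : ∀ l a k C → l + a + k + C ≡ k + a + l + C
  swap = solve-∀
  total : Z w (l + a) + Z w k + C + (O w (l + a) + O w k) ≡ Z w (k + a) + Z w l + (O w (k + a) + O w l + C)
  total = begin
    Z w (l + a) + Z w k + C + (O w (l + a) + O w k)     ≡⟨ split (Z w (l + a)) (Z w k) (O w (l + a)) (O w k) C ⟩
    (Z w (l + a) + O w (l + a)) + (Z w k + O w k) + C   ≡⟨ cong₂ (λ x y → x + y + C) (Z+O w (l + a)) (Z+O w k) ⟩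
    l + a + k + C                                       ≡⟨ swap l a k C ⟩
    k + a + l + C                                       ≡⟨ cong₂ (λ x y → x + y + C) (Z+O w (k + a)) (Z+O w l) ⟨
    (Z w (k + a) + O w (k + a)) + (Z w l + O w l) + C   ≡⟨ split′ (Z w (k + a)) (Z w l) (O w (k + a)) (O w l) C ⟨
    Z w (k + a) + Z w l + (O w (k + a) + O w l + C)     ∎
    where open ≡-Reasoning

-- The factor shared by the NCF and the dual substitutions.

-- The `τ` of the opening comment, for the digit `m`; its `θ` is `blowup` below.
runSubst : ℕ → Substitution
runSubst m 0F = replicate m 0F ++⁺ List⁺.[ 1F ]
runSubst m 1F = List⁺.[ 0F ]

image-replicate-0 : ∀ (σ : Substitution) → toList (σ 0F) ≡ [ 0F ] → ∀ n v →
  image σ (replicate n 0F ++ v) ≡ replicate n 0F ++ image σ v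
image-replicate-0 σ σ0≡ zero    v = refl
image-replicate-0 σ σ0≡ (suc n) v = cong₂ _++_ σ0≡ (image-replicate-0 σ σ0≡ n v)

image-replicate-1 : ∀ (σ : Substitution) → toList (σ 1F) ≡ [ 0F ] → ∀ n →
  image σ (replicate n 1F) ≡ replicate n 0F
image-replicate-1 σ σ1≡ zero    = refl
image-replicate-1 σ σ1≡ (suc n) = cong₂ _++_ σ1≡ (image-replicate-1 σ σ1≡ n)

-- Dual sequences: block positions, the descent step and balance.

module _ (N : ℕ) .{{_ : NonZero N}} where

  toList-power⁺ : ∀ a → toList (power⁺ a N) ≡ replicate N a
  toList-power⁺ a = cong (λ n → replicate n a) (suc-pred N)

  dual-0 : ∀ d → toList (dualNCFSubst N d 0F) ≡ replicate d 0F ++ [ 1F ]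
  dual-0 d = toList-++⁺ (replicate d 0F) List⁺.[ 1F ]

  length-dual-0 : ∀ d → length (toList (dualNCFSubst N d 0F)) ≡ suc d
  length-dual-0 d = trans (cong length (dual-0 d)) (trans (length-++ (replicate d 0F))
    (trans (cong (_+ 1) (length-replicate d)) (+-comm d 1)))

  length-power⁺ : ∀ a → length (toList (power⁺ a N)) ≡ N
  length-power⁺ a = trans (cong length (toList-power⁺ a)) (length-replicate N)

  length-dual : ∀ d a → N ≤ d → length (toList (dualNCFSubst N d a)) ≤ suc d
  length-dual d 0F N≤d = ≤-reflexive (length-dual-0 d)
  length-dual d 1F N≤d = ≤-trans (≤-reflexive (length-power⁺ 0F)) (m≤n⇒m≤1+n N≤d)

  take-power⁺ : ∀ a r → r < length (toList (power⁺ a N)) → take r (toList (power⁺ a N)) ≡ replicate r a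
  take-power⁺ a r r< = trans (cong (take r) (toList-power⁺ a))
    (take-replicate a (<⇒≤ (subst (r <_) (length-power⁺ a) r<)))

  -- The only 1 in any image is the last letter of the image of 0, which a proper prefix never
  -- reaches.
  take-dual : ∀ d r a → r < length (toList (dualNCFSubst N d a)) →
    take r (toList (dualNCFSubst N d a)) ≡ replicate r 0F
  take-dual d r 0F r< = trans (cong (take r) (dual-0 d))
    (take-replicate-++ 0F [ 1F ] (s≤s⁻¹ (subst (r <_) (length-dual-0 d) r<)))
  take-dual d r 1F r< = take-power⁺ 0F r r<

  -- The incomplete block at `p` contributes zeros only, so the ones before `p` are the final
  -- letters of the complete images of 0. Complete blocks have length `suc d` or `N`, and `N ≤ d`
  -- keeps the offset `r` at most `d`.
  dual-position : ∀ d {ν w} → N ≤ d → ν ≗ dualNCFSubst N d ⟨ w ⟩ → ∀ p →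
    ∃₂ λ k r → r ≤ d × O ν p ≡ Z w k × p ≡ suc d * Z w k + N * O w k + r
  dual-position d {ν} {w} N≤d ν≗ p with ⟨⟩-prefix (dualNCFSubst N d) w p
  ... | k , r , r< , eq = k , r , s≤s⁻¹ (≤-trans r< (length-dual d (w k) N≤d)) , Oν , p≡
    where
    open ≡-Reasoning
    σ = dualNCFSubst N d
    prefix : applyUpTo ν p ≡ image σ (applyUpTo w k) ++ replicate r 0F
    prefix = trans (applyUpTo-cong ν≗ p) (trans eq
      (cong (image σ (applyUpTo w k) ++_) (take-dual d r (w k) r<)))
    counts : ∀ a → count a ν p ≡
      ∣ replicate d 0F ++ [ 1F ] ∣[ a ] * Z w k + ∣ replicate N 0F ∣[ a ] * O w k + ∣ replicate r 0F ∣[ a ]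
    counts a = begin
      count a ν p                                                  ≡⟨ cong ∣_∣[ a ] prefix ⟩
      ∣ image σ (applyUpTo w k) ++ replicate r 0F ∣[ a ]           ≡⟨ count-++ a (image σ (applyUpTo w k)) _ ⟩
      ∣ image σ (applyUpTo w k) ∣[ a ] + ∣ replicate r 0F ∣[ a ]   ≡⟨ cong (_+ ∣ replicate r 0F ∣[ a ]) (count-image σ a (applyUpTo w k)) ⟩
      ∣ toList (σ 0F) ∣[ a ] * Z w k + ∣ toList (σ 1F) ∣[ a ] * O w k + ∣ replicate r 0F ∣[ a ]
        ≡⟨ cong₂ (λ u v → ∣ u ∣[ a ] * Z w k + ∣ v ∣[ a ] * O w k + ∣ replicate r 0F ∣[ a ]) (dual-0 d) (toList-power⁺ 0F) ⟩
      ∣ replicate d 0F ++ [ 1F ] ∣[ a ] * Z w k + ∣ replicate N 0F ∣[ a ] * O w k + ∣ replicate r 0F ∣[ a ]   ∎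
    Oν : O ν p ≡ Z w k
    Oν = begin
      O ν p   ≡⟨ counts 1F ⟩
      ∣ replicate d 0F ++ [ 1F ] ∣[ 1F ] * Z w k + ∣ replicate N 0F ∣[ 1F ] * O w k + ∣ replicate r 0F ∣[ 1F ]
        ≡⟨ cong₂ _+_ (cong₂ (λ x y → x * Z w k + y * O w k)
             (trans (count-++ 1F (replicate d 0F) [ 1F ]) (cong (_+ 1) (count-1-replicate-0 d)))
             (count-1-replicate-0 N)) (count-1-replicate-0 r) ⟩
      1 * Z w k + 0 * O w k + 0   ≡⟨ simplify (Z w k) ⟩
      Z w k   ∎
      where
      simplify : ∀ z → 1 * z + 0 + 0 ≡ z
      simplify = solve-∀
    Zν : Z ν p ≡ d * Z w k + N * O w k + r
    Zν = trans (counts 0F) (cong₂ _+_ (cong₂ (λ x y → x * Z w k + y * O w k)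
      (trans (count-++ 0F (replicate d 0F) [ 1F ]) (trans (+-identityʳ _) (count-same 0F d)))
      (count-same 0F N)) (count-same 0F r))
    p≡ : p ≡ suc d * Z w k + N * O w k + r
    p≡ = begin
      p                                      ≡⟨ Z+O ν p ⟨
      Z ν p + O ν p                          ≡⟨ cong₂ _+_ Zν Oν ⟩
      d * Z w k + N * O w k + r + Z w k      ≡⟨ collect d N (Z w k) (O w k) r ⟩
      suc d * Z w k + N * O w k + r          ∎
      where
      collect : ∀ d N z o r → d * z + N * o + r + z ≡ suc d * z + N * o + r
      collect = solve-∀

  -- The numerical hypothesis says that `suc C` surplus images of 0 are too long to be made up for
  -- by `C` images of 1 together with two incomplete blocks of at most `d` letters each.
  dual-step : ∀ C d {ν w} → N ≤ d → 1 ≤ C → N * C + 2 * d < suc d * suc C → ν ≗ dualNCFSubst N d ⟨ w ⟩ →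
    ∀ n → (∀ m → m < n → OnesBalanced C w m) → OnesBalanced C ν n
  dual-step C d {ν} {w} N≤d 1≤C bound ν≗ n bal i j
    with dual-position d N≤d ν≗ i | dual-position d N≤d ν≗ (i + n)
       | dual-position d N≤d ν≗ j | dual-position d N≤d ν≗ (j + n)
  -- The factor at `i` is the one assumed to be too rich in ones: its ends lie in the blocks `k` and
  -- `k′`, so w[k, k′) is the word A of the opening comment and w[l, l′) is B.
  ... | k , r , r≤d , Oi , i≡ | k′ , r′ , _ , Oi+n , i+n≡ | l , s , _ , Oj , j≡ | l′ , s′ , s′≤d , Oj+n , j+n≡ =
    ≮⇒≥ λ unbalanced → let hZ = excess-Z unbalanced in
      no-double-excess C w k k′ l l′ (λ m m≤ → bal m (≤-<-trans m≤ (shorter (Zk+2≤Zk′ hZ)))) Zl≤Zl′ hZ (excess-O hZ)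
    where
    excess-Z : O ν (j + n) + O ν i + C < O ν (i + n) + O ν j → Z w l′ + Z w k + C < Z w k′ + Z w l
    excess-Z h rewrite Oi | Oi+n | Oj | Oj+n = h

    -- The four positions are located independently, so the order of their blocks has to be
    -- recovered from the monotonicity of counts.
    Zl≤Zl′ : Z w l ≤ Z w l′
    Zl≤Zl′ = ≤-trans (≤-reflexive (sym Oj)) (≤-trans (count-mono 1F ν (m≤m+n j n)) (≤-reflexive Oj+n))

    -- This is where `1 ≤ C` enters: A has more than `C` zeros, hence at least two.
    Zk+2≤Zk′ : Z w l′ + Z w k + C < Z w k′ + Z w l → Z w k + 2 ≤ Z w k′
    Zk+2≤Zk′ hZ = +-cancelʳ-≤ (Z w l) _ _ (≤-trans
      (≤-trans (≤-reflexive (rearrange (Z w k) (Z w l))) (s≤s (+-mono-≤ (+-monoˡ-≤ (Z w k) Zl≤Zl′) 1≤C))) hZ)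
      where
      rearrange : ∀ x y → x + 2 + y ≡ suc (y + x + 1)
      rearrange = solve-∀

    -- Let A have `2 + z` zeros and `o` ones. Each image has at least one letter and each image of 0
    -- has `d` further ones, so two zeros make the image of A at least 2d letters longer than A. At
    -- most `d` letters are lost at the left end, which leaves `n` at least `d` above the length of
    -- A, and `d` is positive.
    shorter : Z w k + 2 ≤ Z w k′ → k′ ∸ k < n
    shorter Zk+2≤Zk′
      with m≤n⇒∃[o]m+o≡n Zk+2≤Zk′
         | m≤n⇒∃[o]m+o≡n (count-mono 1F w {k} {k′} (<⇒≤ (count-cancel-< 0F w
             (<-≤-trans (m<m+n (Z w k) {2} z<s) Zk+2≤Zk′))))
    ... | z , z≡ | o , o≡ = subst (_< n) (sym k′∸k≡) (<-≤-trans (m<n+m _ 1≤d) d+a≤n)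
      where
      1≤d = ≤-trans (>-nonZero⁻¹ N) N≤d
      k′≡ : k′ ≡ k + (2 + z + o)
      k′≡ = begin
        k′                                     ≡⟨ Z+O w k′ ⟨
        Z w k′ + O w k′                        ≡⟨ cong₂ _+_ z≡ o≡ ⟨
        Z w k + 2 + z + (O w k + o)            ≡⟨ rearrange (Z w k) z (O w k) o ⟩
        Z w k + O w k + (2 + z + o)            ≡⟨ cong (_+ (2 + z + o)) (Z+O w k) ⟩
        k + (2 + z + o)                        ∎
        where
        open ≡-Reasoning
        rearrange : ∀ x z y o → x + 2 + z + (y + o) ≡ x + y + (2 + z + o)
        rearrange = solve-∀
      k′∸k≡ : k′ ∸ k ≡ 2 + z + o
      k′∸k≡ = trans (cong (_∸ k) k′≡) (m+n∸m≡n k _)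
      lengths : suc d * (2 + z) + N * o + r′ ≡ r + n
      lengths = +-cancelˡ-≡ (suc d * Z w k + N * O w k) _ _ (begin
        suc d * Z w k + N * O w k + (suc d * (2 + z) + N * o + r′)    ≡⟨ expand (suc d) N (Z w k) (O w k) z o r′ ⟩
        suc d * (Z w k + 2 + z) + N * (O w k + o) + r′               ≡⟨ cong₂ (λ x y → suc d * x + N * y + r′) z≡ o≡ ⟩
        suc d * Z w k′ + N * O w k′ + r′                             ≡⟨ i+n≡ ⟨
        i + n                                                        ≡⟨ cong (_+ n) i≡ ⟩
        suc d * Z w k + N * O w k + r + n                            ≡⟨ +-assoc _ r n ⟩
        suc d * Z w k + N * O w k + (r + n)                          ∎)
        where
        open ≡-Reasoning
        expand : ∀ D N x y z o r → D * x + N * y + (D * (2 + z) + N * o + r) ≡ D * (x + 2 + z) + N * (y + o) + r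
        expand = solve-∀
      d+a≤n : d + (2 + z + o) ≤ n
      d+a≤n = +-cancelˡ-≤ d _ _ (begin
        d + (d + (2 + z + o))                     ≡⟨ rearrange d z o ⟩
        d * 2 + (2 + z) + o                       ≤⟨ +-mono-≤ (+-monoˡ-≤ (2 + z) (*-monoʳ-≤ d (m≤m+n 2 z))) (m≤n*m o N) ⟩
        d * (2 + z) + (2 + z) + N * o             ≡⟨ cong (_+ N * o) (+-comm (d * (2 + z)) (2 + z)) ⟩
        suc d * (2 + z) + N * o                   ≤⟨ m≤m+n _ r′ ⟩
        suc d * (2 + z) + N * o + r′              ≡⟨ lengths ⟩
        r + n                                     ≤⟨ +-monoˡ-≤ n r≤d ⟩
        d + n                                     ∎)
        where
        open ≤-Reasoning
        rearrange : ∀ d z o → d + (d + (2 + z + o)) ≡ d * 2 + (2 + z) + o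
        rearrange = solve-∀

    excess-O : Z w l′ + Z w k + C < Z w k′ + Z w l → O w k′ + O w l + C < O w l′ + O w k
    -- If the excess of ones in B were at most `C`, comparing the two equal lengths would contradict
    -- `bound`. The block-length sums of both sides are added throughout, so that the comparison
    -- runs without subtraction.
    excess-O hZ = ≰⇒> λ hO → <⇒≱ bound (+-cancelˡ-≤ (D * (Zk′ + Zl) + N * (Ok′ + Ol) + (D * (Zl′ + Zk) + N * (Ol′ + Ok))) _ _ (begin
      D * (Zk′ + Zl) + N * (Ok′ + Ol) + (D * (Zl′ + Zk) + N * (Ol′ + Ok)) + D * suc C
        ≡⟨ expandˡ D N Zk′ Zl Ok′ Ol Zl′ Zk Ol′ Ok C ⟩
      D * suc (Zl′ + Zk + C) + N * (Ol′ + Ok) + (D * (Zk′ + Zl) + N * (Ok′ + Ol))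
        ≤⟨ +-mono-≤ (+-mono-≤ (*-monoʳ-≤ D hZ) (*-monoʳ-≤ N hO)) (m≤m+n _ (r′ + s)) ⟩
      D * (Zk′ + Zl) + N * (Ok′ + Ol + C) + (D * (Zk′ + Zl) + N * (Ok′ + Ol) + (r′ + s))
        ≡⟨ cong (λ x → D * (Zk′ + Zl) + N * (Ok′ + Ol + C) + x) lengths ⟩
      D * (Zk′ + Zl) + N * (Ok′ + Ol + C) + (D * (Zl′ + Zk) + N * (Ol′ + Ok) + (s′ + r))
        ≤⟨ +-monoʳ-≤ (D * (Zk′ + Zl) + N * (Ok′ + Ol + C)) (+-monoʳ-≤ (D * (Zl′ + Zk) + N * (Ol′ + Ok)) (+-mono-≤ s′≤d r≤d)) ⟩
      D * (Zk′ + Zl) + N * (Ok′ + Ol + C) + (D * (Zl′ + Zk) + N * (Ol′ + Ok) + (d + d))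
        ≡⟨ expandʳ (D * (Zk′ + Zl)) N (Ok′ + Ol) C (D * (Zl′ + Zk) + N * (Ol′ + Ok)) d ⟩
      D * (Zk′ + Zl) + N * (Ok′ + Ol) + (D * (Zl′ + Zk) + N * (Ol′ + Ok)) + (N * C + 2 * d)   ∎))
      where
      open ≤-Reasoning
      D = suc d
      Zk = Z w k
      Zk′ = Z w k′
      Zl = Z w l
      Zl′ = Z w l′
      Ok = O w k
      Ok′ = O w k′
      Ol = O w l
      Ol′ = O w l′
      expandˡ : ∀ D N a b c e f g h i C →
        D * (a + b) + N * (c + e) + (D * (f + g) + N * (h + i)) + D * suc C ≡
        D * suc (f + g + C) + N * (h + i) + (D * (a + b) + N * (c + e))
      expandˡ = solve-∀
      expandʳ : ∀ x N y C t d → x + N * (y + C) + (t + (d + d)) ≡ x + N * y + t + (N * C + 2 * d)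
      expandʳ = solve-∀
      pair : ∀ D N x y z t r s → D * (x + y) + N * (z + t) + (r + s) ≡ (D * x + N * z + r) + (D * y + N * t + s)
      pair = solve-∀
      swap : ∀ i n j → (i + n) + j ≡ (j + n) + i
      swap = solve-∀
      lengths : D * (Zk′ + Zl) + N * (Ok′ + Ol) + (r′ + s) ≡ D * (Zl′ + Zk) + N * (Ol′ + Ok) + (s′ + r)
      lengths = begin-equality
        D * (Zk′ + Zl) + N * (Ok′ + Ol) + (r′ + s)                   ≡⟨ pair D N Zk′ Zl Ok′ Ol r′ s ⟩
        (D * Zk′ + N * Ok′ + r′) + (D * Zl + N * Ol + s)             ≡⟨ cong₂ _+_ i+n≡ j≡ ⟨
        (i + n) + j                                                  ≡⟨ swap i n j ⟩
        (j + n) + i                                                  ≡⟨ cong₂ _+_ j+n≡ i≡ ⟩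
        (D * Zl′ + N * Ol′ + s′) + (D * Zk + N * Ok + r)             ≡⟨ pair D N Zl′ Zk Ol′ Ok s′ r ⟨
        D * (Zl′ + Zk) + N * (Ol′ + Ok) + (s′ + r)                   ∎

  dual-balanced : ∀ C (d : ℕ → ℕ) → (∀ t → N ≤ d t) → 1 ≤ C → (∀ t → N * C + 2 * d t < suc (d t) * suc C) →
    ∀ {ν} → IsDirectedBy (dualNCFSubst N ∘ d) ν → ∀ n → OnesBalanced C ν n
  dual-balanced C d N≤d 1≤C bound {ν} (νs , ν₀≗ν , νs≗) n i j =
    subst₂ _≤_ (cong₂ _+_ (O≡ (i + n)) (O≡ j)) (cong (_+ C) (cong₂ _+_ (O≡ (j + n)) (O≡ i))) (all n 0 i j)
    where
    O≡ : ∀ p → O (νs 0) p ≡ O ν p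
    O≡ p = cong ∣_∣[ 1F ] (applyUpTo-cong ν₀≗ν p)
    -- Strong induction on the length for all levels at once: the step at level `t` uses smaller
    -- lengths at level `suc t`.
    all : ∀ n t → OnesBalanced C (νs t) n
    all = <-rec (λ n → ∀ t → OnesBalanced C (νs t) n) λ n rec t →
      dual-step C (d t) (N≤d t) 1≤C (bound t) (νs≗ t) n (λ m m<n → rec m<n (suc t))

  -- NCF sequences as blow-ups of dual sequences.

  blowup : Substitution
  blowup 0F = List⁺.[ 0F ]
  blowup 1F = power⁺ 1F N

  -- Rounding a position inside a block 1ᴺ down and up to the ends of that block.
  blowup-position : ∀ {ω ν} → ω ≗ blowup ⟨ ν ⟩ → ∀ p →
    ∃₂ λ k k⁺ → Z ω p ≡ Z ν k × Z ω p ≡ Z ν k⁺ × N * O ν k ≤ O ω p × O ω p ≤ N * O ν k⁺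
  blowup-position {ω} {ν} ω≗ p with ⟨⟩-prefix blowup ν p
  ... | k , r , r< , eq = k , round (ν k) refl r r< (counts 0F) (counts 1F)
    where
    counts : ∀ a → count a ω p ≡
      ∣ [ 0F ] ∣[ a ] * Z ν k + ∣ replicate N 1F ∣[ a ] * O ν k + ∣ take r (toList (blowup (ν k))) ∣[ a ]
    counts a = begin
      count a ω p
        ≡⟨ cong ∣_∣[ a ] (trans (applyUpTo-cong ω≗ p) eq) ⟩
      ∣ image blowup (applyUpTo ν k) ++ take r (toList (blowup (ν k))) ∣[ a ]
        ≡⟨ count-++ a (image blowup (applyUpTo ν k)) _ ⟩
      ∣ image blowup (applyUpTo ν k) ∣[ a ] + ∣ take r (toList (blowup (ν k))) ∣[ a ]
        ≡⟨ cong (_+ ∣ take r (toList (blowup (ν k))) ∣[ a ]) (count-image blowup a (applyUpTo ν k)) ⟩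
      ∣ [ 0F ] ∣[ a ] * Z ν k + ∣ toList (power⁺ 1F N) ∣[ a ] * O ν k + ∣ take r (toList (blowup (ν k))) ∣[ a ]
        ≡⟨ cong (λ u → ∣ [ 0F ] ∣[ a ] * Z ν k + ∣ u ∣[ a ] * O ν k + ∣ take r (toList (blowup (ν k))) ∣[ a ]) (toList-power⁺ 1F) ⟩
      ∣ [ 0F ] ∣[ a ] * Z ν k + ∣ replicate N 1F ∣[ a ] * O ν k + ∣ take r (toList (blowup (ν k))) ∣[ a ]   ∎
      where open ≡-Reasoning

    zeros : ∀ r → 1 * Z ν k + ∣ replicate N 1F ∣[ 0F ] * O ν k + ∣ replicate r 1F ∣[ 0F ] ≡ Z ν k
    zeros r = trans (cong₂ (λ x y → 1 * Z ν k + x * O ν k + y) (count-0-replicate-1 N) (count-0-replicate-1 r))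
      (simplify (Z ν k))
      where
      simplify : ∀ z → 1 * z + 0 + 0 ≡ z
      simplify = solve-∀

    ones : ∀ r → 0 * Z ν k + ∣ replicate N 1F ∣[ 1F ] * O ν k + ∣ replicate r 1F ∣[ 1F ] ≡ N * O ν k + r
    ones r = cong₂ (λ x y → x * O ν k + y) (count-same 1F N) (count-same 1F r)

    round : ∀ a → ν k ≡ a → ∀ r → r < length (toList (blowup a)) →
      Z ω p ≡ 1 * Z ν k + ∣ replicate N 1F ∣[ 0F ] * O ν k + ∣ take r (toList (blowup a)) ∣[ 0F ] →
      O ω p ≡ 0 * Z ν k + ∣ replicate N 1F ∣[ 1F ] * O ν k + ∣ take r (toList (blowup a)) ∣[ 1F ] →
      ∃ λ k⁺ → Z ω p ≡ Z ν k × Z ω p ≡ Z ν k⁺ × N * O ν k ≤ O ω p × O ω p ≤ N * O ν k⁺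
    round 0F νk≡ zero r< Z≡ O≡ = k , Z≡′ , Z≡′ , ≤-reflexive (sym O≡′) , ≤-reflexive O≡′
      where
      Z≡′ = trans Z≡ (zeros 0)
      O≡′ = trans O≡ (trans (ones 0) (+-identityʳ _))
    round 0F νk≡ (suc r) (s≤s ()) Z≡ O≡
    round 1F νk≡ r r< Z≡ O≡ = suc k , Z≡′ , trans Z≡′ (sym Zsuc) ,
      ≤-trans (m≤m+n _ r) (≤-reflexive (sym O≡′)) ,
      ≤-trans (≤-reflexive O≡′) (≤-trans (+-monoʳ-≤ (N * O ν k) r≤N) (≤-reflexive (sym N*Osuc)))
      where
      r≤N : r ≤ N
      r≤N = <⇒≤ (subst (r <_) (length-power⁺ 1F) r<)
      Z≡′ : Z ω p ≡ Z ν k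
      Z≡′ = trans Z≡ (trans (cong (λ u → 1 * Z ν k + ∣ replicate N 1F ∣[ 0F ] * O ν k + ∣ u ∣[ 0F ])
        (take-power⁺ 1F r r<)) (zeros r))
      O≡′ : O ω p ≡ N * O ν k + r
      O≡′ = trans O≡ (trans (cong (λ u → 0 * Z ν k + ∣ replicate N 1F ∣[ 1F ] * O ν k + ∣ u ∣[ 1F ])
        (take-power⁺ 1F r r<)) (ones r))
      step : ∀ a → count a ν (suc k) ≡ count a ν k + ∣ [ 1F ] ∣[ a ]
      step a = trans (cong ∣_∣[ a ] (sym (applyUpTo-∷ʳ ν k)))
        (trans (count-++ a (applyUpTo ν k) [ ν k ]) (cong (λ b → count a ν k + ∣ [ b ] ∣[ a ]) νk≡))
      Zsuc : Z ν (suc k) ≡ Z ν k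
      Zsuc = trans (step 0F) (+-identityʳ _)
      N*Osuc : N * O ν (suc k) ≡ N * O ν k + N
      N*Osuc = trans (cong (N *_) (step 1F)) (trans (*-distribˡ-+ N (O ν k) 1) (cong (λ x → N * O ν k + x) (*-identityʳ N)))

  -- The factor with too many ones is rounded outwards and the other one inwards. This leaves the
  -- zeros unchanged and can only increase the excess of ones, which exceeds `N * C` letters and so
  -- becomes more than `C` blocks. By equality of lengths the other factor has more than `N * C`,
  -- hence more than `C`, zeros in excess.
  blowup-balanced : ∀ C {ω ν} → ω ≗ blowup ⟨ ν ⟩ → (∀ n → OnesBalanced C ν n) → ∀ n → OnesBalanced (N * C) ω n
  blowup-balanced C {ω} {ν} ω≗ bal n i j
    with blowup-position ω≗ i | blowup-position ω≗ (i + n)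
       | blowup-position ω≗ j | blowup-position ω≗ (j + n)
  -- Rounded down at `i` and `j + n`, rounded up at `i + n` and `j`.
  ... | l , _ , Zi , _ , Oi , _ | _ , l′ , _ , Zi+n , _ , Oi+n | _ , k , _ , Zj , _ , Oj | k′ , _ , Zj+n , _ , Oj+n , _ =
    ≮⇒≥ λ unbalanced →
      no-double-excess C ν k k′ l l′ (λ m _ → bal m) Zl≤Zl′ (excess-Z unbalanced) (excess-O unbalanced)
    where
    Zl≤Zl′ : Z ν l ≤ Z ν l′
    Zl≤Zl′ = ≤-trans (≤-reflexive (sym Zi)) (≤-trans (count-mono 0F ω (m≤m+n i n)) (≤-reflexive Zi+n))

    excess-Z : O ω (j + n) + O ω i + N * C < O ω (i + n) + O ω j → Z ν l′ + Z ν k + C < Z ν k′ + Z ν l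
    excess-Z h = subst₂ _<_ (cong (_+ C) (cong₂ _+_ Zi+n Zj)) (cong₂ _+_ Zj+n Zi) (≰⇒> λ hZ →
      <-irrefl refl (begin-strict
        (j + n) + i + C                                                      ≤⟨ +-monoʳ-≤ ((j + n) + i) (m≤n*m C N) ⟩
        (j + n) + i + N * C                                                  ≡⟨ cong₂ (λ x y → x + y + N * C) (Z+O ω (j + n)) (Z+O ω i) ⟨
        (Z ω (j + n) + O ω (j + n)) + (Z ω i + O ω i) + N * C                ≡⟨ split (Z ω (j + n)) (O ω (j + n)) (Z ω i) (O ω i) (N * C) ⟩
        (O ω (j + n) + O ω i + N * C) + (Z ω (j + n) + Z ω i)                <⟨ +-mono-<-≤ h hZ ⟩
        (O ω (i + n) + O ω j) + (Z ω (i + n) + Z ω j + C)                    ≡⟨ split′ (Z ω (i + n)) (O ω (i + n)) (Z ω j) (O ω j) C ⟨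
        (Z ω (i + n) + O ω (i + n)) + (Z ω j + O ω j) + C                    ≡⟨ cong₂ (λ x y → x + y + C) (Z+O ω (i + n)) (Z+O ω j) ⟩
        (i + n) + j + C                                                      ≡⟨ cong (_+ C) (swap i n j) ⟩
        (j + n) + i + C                                                      ∎))
      where
      open ≤-Reasoning
      split : ∀ a b c d x → (a + b) + (c + d) + x ≡ (b + d + x) + (a + c)
      split = solve-∀
      split′ : ∀ a b c d x → (a + b) + (c + d) + x ≡ (b + d) + (a + c + x)
      split′ = solve-∀
      swap : ∀ i n j → (i + n) + j ≡ (j + n) + i
      swap = solve-∀

    excess-O : O ω (j + n) + O ω i + N * C < O ω (i + n) + O ω j → O ν k′ + O ν l + C < O ν l′ + O ν k
    excess-O h = *-cancelˡ-< N _ _ (begin-strict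
      N * (O ν k′ + O ν l + C)             ≡⟨ expand N (O ν k′) (O ν l) C ⟩
      N * O ν k′ + N * O ν l + N * C       ≤⟨ +-monoˡ-≤ (N * C) (+-mono-≤ Oj+n Oi) ⟩
      O ω (j + n) + O ω i + N * C          <⟨ h ⟩
      O ω (i + n) + O ω j                  ≤⟨ +-mono-≤ Oi+n Oj ⟩
      N * O ν l′ + N * O ν k               ≡⟨ *-distribˡ-+ N (O ν l′) (O ν k) ⟨
      N * (O ν l′ + O ν k)                 ∎)
      where
      open ≤-Reasoning
      expand : ∀ N a b c → N * (a + b + c) ≡ N * a + N * b + N * c
      expand = solve-∀

  ncf≡blowup∘run : ∀ d a → toList (ncfSubst N d a) ≡ image blowup (toList (runSubst d a))
  ncf≡blowup∘run d 0F = begin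
    toList (replicate d 0F ++⁺ power⁺ 1F N)             ≡⟨ toList-++⁺ (replicate d 0F) (power⁺ 1F N) ⟩
    replicate d 0F ++ toList (power⁺ 1F N)              ≡⟨ cong (replicate d 0F ++_) (++-identityʳ _) ⟨
    replicate d 0F ++ image blowup [ 1F ]               ≡⟨ image-replicate-0 blowup refl d [ 1F ] ⟨
    image blowup (replicate d 0F ++ [ 1F ])             ≡⟨ cong (image blowup) (toList-++⁺ (replicate d 0F) List⁺.[ 1F ]) ⟨
    image blowup (toList (runSubst d 0F))               ∎
    where open ≡-Reasoning
  ncf≡blowup∘run d 1F = refl

  dual≡run∘blowup : ∀ d a → toList (dualNCFSubst N d a) ≡ image (runSubst d) (toList (blowup a))
  dual≡run∘blowup d 0F = sym (++-identityʳ _)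
  dual≡run∘blowup d 1F = trans (toList-power⁺ 0F)
    (sym (trans (cong (image (runSubst d)) (toList-power⁺ 1F)) (image-replicate-1 (runSubst d) refl N)))

  -- Regroup θτ₀θτ₁θτ₂⋯ as θ(τ₀θ)(τ₁θ)⋯: the dual words are the intermediate words, where `runSubst`
  -- has been applied to the next NCF word but `blowup` has not.
  ncf-factors-through-dual : ∀ (d : ℕ → ℕ) {ω} → IsDirectedBy (ncfSubst N ∘ d) ω →
    ∃ λ ν → IsDirectedBy (dualNCFSubst N ∘ d) ν × ω ≗ blowup ⟨ ν ⟩
  ncf-factors-through-dual d {ω} (ωs , ω₀≗ω , ωs≗) = νs 0 , (νs , (λ _ → refl) , νs≗) ,
    λ k → trans (sym (ω₀≗ω k)) (ωs≗blowup 0 k)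
    where
    νs : ℕ → Word∞
    νs n = runSubst (d n) ⟨ ωs (suc n) ⟩
    ωs≗blowup : ∀ n → ωs n ≗ blowup ⟨ νs n ⟩
    ωs≗blowup n k = trans (ωs≗ n k)
      (sym (⟨⟩-∘ blowup (runSubst (d n)) (ncfSubst N (d n)) (ncf≡blowup∘run (d n)) (ωs (suc n)) k))
    νs≗ : ∀ n → νs n ≗ dualNCFSubst N (d n) ⟨ νs (suc n) ⟩
    νs≗ n k = trans (⟨⟩-cong (runSubst (d n)) (ωs≗blowup (suc n)) k)
      (⟨⟩-∘ (runSubst (d n)) blowup (dualNCFSubst N (d n)) (dual≡run∘blowup (d n)) (νs (suc n)) k)

-- The inequality that determines the balance constant.

-- Put `d = K + x` and let `c` be the quotient. As `K + 1 = N + e`, the right side minus the left is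
-- 2 + ec + xc - N. Division with remainder gives `K ∸ 1 < e + c * e`, hence N < 2 + ec.
bound-from-digits : ∀ N K d e .{{_ : NonZero e}} → N + e ≡ K + 1 → K ≤ d →
  let C = (K ∸ 1) / e + 1 in N * C + 2 * d < suc d * suc C
bound-from-digits N K d e N+e≡ K≤d with m≤n⇒∃[o]m+o≡n K≤d
-- The added term is the positive part of that difference; with it on both sides, only `N` remains
-- to be compared with it.
... | x , refl = +-cancelʳ-< (2 + (e * c + x * c)) _ _ (begin-strict
    N * (c + 1) + 2 * (K + x) + (2 + (e * c + x * c))   ≡⟨ collect N c K x e ⟩
    N * (c + 1) + 2 * (K + 1 + x) + (e * c + x * c)     ≡⟨ cong (λ y → N * (c + 1) + 2 * (y + x) + (e * c + x * c)) N+e≡ ⟨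
    N * (c + 1) + 2 * (N + e + x) + (e * c + x * c)     ≡⟨ factor N c e x ⟩
    (N + e + x) * (2 + c) + N                           <⟨ +-monoʳ-< ((N + e + x) * (2 + c)) N<ec+2 ⟩
    (N + e + x) * (2 + c) + (2 + (e * c + x * c))       ≡⟨ cong (λ y → (y + x) * (2 + c) + (2 + (e * c + x * c))) N+e≡ ⟩
    (K + 1 + x) * (2 + c) + (2 + (e * c + x * c))       ≡⟨ cong (_+ (2 + (e * c + x * c))) (shift K x c) ⟩
    suc (K + x) * suc (c + 1) + (2 + (e * c + x * c))   ∎)
  where
  open ≤-Reasoning
  c = (K ∸ 1) / e
  collect : ∀ N c K x e → N * (c + 1) + 2 * (K + x) + (2 + (e * c + x * c)) ≡
    N * (c + 1) + 2 * (K + 1 + x) + (e * c + x * c)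
  collect = solve-∀
  factor : ∀ N c e x → N * (c + 1) + 2 * (N + e + x) + (e * c + x * c) ≡ (N + e + x) * (2 + c) + N
  factor = solve-∀
  shift : ∀ K x c → (K + 1 + x) * (2 + c) ≡ suc (K + x) * suc (c + 1)
  shift = solve-∀
  regroup : ∀ e m → suc (e + m) + 1 ≡ (2 + m) + e
  regroup = solve-∀
  N<ec+2 : N < 2 + (e * c + x * c)
  N<ec+2 = +-cancelʳ-< e _ _ (begin-strict
    N + e                         ≡⟨ N+e≡ ⟩
    K + 1                         ≤⟨ +-monoˡ-≤ 1 (m≤n+m∸n K 1) ⟩
    suc (K ∸ 1) + 1               ≡⟨ cong (λ y → suc y + 1) (m≡m%n+[m/n]*n (K ∸ 1) e) ⟩
    suc ((K ∸ 1) % e + c * e) + 1 <⟨ +-monoˡ-< 1 (s<s (+-monoˡ-< (c * e) (m%n<n (K ∸ 1) e))) ⟩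
    suc (e + c * e) + 1           ≡⟨ regroup e (c * e) ⟩
    2 + c * e + e                 ≡⟨ cong (λ y → 2 + y + e) (*-comm c e) ⟩
    2 + e * c + e                 ≤⟨ +-monoˡ-≤ e (+-monoʳ-≤ 2 (m≤m+n (e * c) (x * c))) ⟩
    2 + (e * c + x * c) + e       ∎)

-- From prefix counts to factors and integer differences.

difference-≤ : ∀ {x y C} → x ≤ y + C → + x ℤ.- + y ℤ.≤ + C
difference-≤ {x} {y} {C} x≤y+C = begin
  + x ℤ.- + y              ≤⟨ ℤ.+-monoˡ-≤ (ℤ.- + y) (ℤ.+≤+ x≤y+C) ⟩
  + (y + C) ℤ.- + y        ≡⟨ ℤ.m-n≡m⊖n (y + C) y ⟩
  (y + C) ℤ.⊖ y            ≡⟨ ℤ.⊖-≥ (m≤m+n y C) ⟩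
  + (y + C ∸ y)            ≡⟨ cong +_ (m+n∸m≡n y C) ⟩
  + C                      ∎
  where open ℤ.≤-Reasoning

difference-≥ : ∀ {x y C} → y ≤ x + C → ℤ.- + C ℤ.≤ + x ℤ.- + y
difference-≥ {x} {y} {C} y≤x+C =
  subst (ℤ.- + C ℤ.≤_) (trans (cong ℤ.-_ (ℤ.m-n≡m⊖n y x)) (trans (sym (ℤ.⊖-swap x y)) (sym (ℤ.m-n≡m⊖n x y))))
    (ℤ.neg-mono-≤ (difference-≤ {y} {x} y≤x+C))

factor-ones : ∀ C ν → (∀ n → OnesBalanced C ν n) → ∀ u v → IsFactor u ν → IsFactor v ν →
  length u ≡ length v → ∣ u ∣[ 1F ] ≤ ∣ v ∣[ 1F ] + C
factor-ones C ν bal u v (i , u≡) (j , v≡) |u|≡|v| = +-cancelˡ-≤ (O ν i + O ν j) _ _ (begin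
  O ν i + O ν j + ∣ u ∣[ 1F ]             ≡⟨ rotate (O ν i) (O ν j) ∣ u ∣[ 1F ] ⟩
  O ν i + ∣ u ∣[ 1F ] + O ν j             ≡⟨ cong (_+ O ν j) (O-end i u u≡) ⟨
  O ν (i + length u) + O ν j              ≤⟨ bal (length u) i j ⟩
  O ν (j + length u) + O ν i + C          ≡⟨ cong (λ n → O ν (j + n) + O ν i + C) |u|≡|v| ⟩
  O ν (j + length v) + O ν i + C          ≡⟨ cong (λ x → x + O ν i + C) (O-end j v v≡) ⟩
  O ν j + ∣ v ∣[ 1F ] + O ν i + C         ≡⟨ collect (O ν j) ∣ v ∣[ 1F ] (O ν i) C ⟩
  O ν i + O ν j + (∣ v ∣[ 1F ] + C)       ∎)
  where
  open ≤-Reasoning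
  O-end : ∀ i u → applyUpTo (λ j → ν (i + j)) (length u) ≡ u → O ν (i + length u) ≡ O ν i + ∣ u ∣[ 1F ]
  O-end i u u≡ = trans (count-+ 1F ν i (length u)) (cong (λ w → O ν i + ∣ w ∣[ 1F ]) u≡)
  rotate : ∀ a b c → a + b + c ≡ a + c + b
  rotate = solve-∀
  collect : ∀ a b c d → a + b + c + d ≡ c + a + (b + d)
  collect = solve-∀

-- At equal lengths a surplus of zeros in `u` is the same surplus of ones in `v`, which is why the
-- two words change roles.
count-0-from-1 : ∀ {C} u v → length u ≡ length v → ∣ v ∣[ 1F ] ≤ ∣ u ∣[ 1F ] + C → ∣ u ∣[ 0F ] ≤ ∣ v ∣[ 0F ] + C
count-0-from-1 {C} u v |u|≡|v| h = +-cancelʳ-≤ ∣ u ∣[ 1F ] _ _ (begin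
  ∣ u ∣[ 0F ] + ∣ u ∣[ 1F ]             ≡⟨ trans (count-total u) (trans |u|≡|v| (sym (count-total v))) ⟩
  ∣ v ∣[ 0F ] + ∣ v ∣[ 1F ]             ≤⟨ +-monoʳ-≤ ∣ v ∣[ 0F ] h ⟩
  ∣ v ∣[ 0F ] + (∣ u ∣[ 1F ] + C)       ≡⟨ rotate ∣ v ∣[ 0F ] ∣ u ∣[ 1F ] C ⟩
  ∣ v ∣[ 0F ] + C + ∣ u ∣[ 1F ]         ∎)
  where
  open ≤-Reasoning
  rotate : ∀ a b c → a + (b + c) ≡ a + c + b
  rotate = solve-∀

onesBalanced⇒balanced : ∀ {C ν} → (∀ n → OnesBalanced C ν n) → Balanced C ν
onesBalanced⇒balanced {C} {ν} bal u v u∈ν v∈ν |u|≡|v| a =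
  difference-≥ (counts v u v∈ν u∈ν (sym |u|≡|v|) a) , difference-≤ (counts u v u∈ν v∈ν |u|≡|v| a)
  where
  counts : ∀ u v → IsFactor u ν → IsFactor v ν → length u ≡ length v → ∀ a → ∣ u ∣[ a ] ≤ ∣ v ∣[ a ] + C
  counts u v u∈ν v∈ν eq 0F = count-0-from-1 u v eq (factor-ones C ν bal v u v∈ν u∈ν (sym eq))
  counts u v u∈ν v∈ν eq 1F = factor-ones C ν bal u v u∈ν v∈ν eq

theorem4p4 : (N K : ℕ) .{{_ : NonZero N}} (N≤K : N ≤ K) →
    (∀ x → W K N x → ∀ ω → IsDualNCFSequence N x ω → Balanced (balanceBound K N N≤K) ω) ×
    (∀ x → W K N x → ∀ ω → IsNCFSequence N x ω → Balanced (N * balanceBound K N N≤K) ω)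
theorem4p4 N K N≤K = dual , ncf
  where
  C = balanceBound K N N≤K

  instance
    _ : NonZero (K + 1 ∸ N)
    _ = >-nonZero (m<n⇒0<n∸m (≤-<-trans N≤K (m<m+n K z<s)))

  dual-ones : ∀ {d ν} → (∀ n → K ≤ d n) → IsDirectedBy (dualNCFSubst N ∘ d) ν → ∀ n → OnesBalanced C ν n
  dual-ones {d} K≤d = dual-balanced N C d (λ t → ≤-trans N≤K (K≤d t)) (m≤n+m 1 _) λ t →
    bound-from-digits N K (d t) (K + 1 ∸ N) (m+[n∸m]≡n (m≤n⇒m≤n+o 1 N≤K)) (K≤d t)

  digits≥K : ∀ {x d} → W K N x → IsNCFDigits N x d → ∀ n → K ≤ d n
  digits≥K {x} (_ , _ , f , K≤) f′ n = ≤-trans (K≤ n) (≤-reflexive (digits-unique N x f f′ n))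

  dual : ∀ x → W K N x → ∀ ω → IsDualNCFSequence N x ω → Balanced C ω
  dual x x∈W ω (d , f , directed) = onesBalanced⇒balanced (dual-ones (digits≥K x∈W f) directed)

  ncf : ∀ x → W K N x → ∀ ω → IsNCFSequence N x ω → Balanced (N * C) ω
  ncf x x∈W ω (d , f , directed) with ncf-factors-through-dual N d directed
  ... | ν , ν-directed , ω≗ =
    onesBalanced⇒balanced (blowup-balanced N C ω≗ (dual-ones (digits≥K x∈W f) ν-directed))
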